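{- Let $G$ be a unicyclic graph of diameter $2$. Then $G$ is group vertex magic if and only if $G$ is the cycle $C_4$ or the cycle $C_5$.
   Context: All graphs are finite, simple and undirected. A unicyclic graph is a connected graph containing exactly one cycle. For an additive abelian group $\mathcal{A}$ with identity $0$, a map $\ell:V(G)\to\mathcal{A}\setminus\{0\}$ is an $\mathcal{A}$-vertex magic labeling if there is $\mu\in\mathcal{A}$ with $\sum_{u\in N(v)}\ell(u)=\mu$ for every vertex $v$; $G$ is $\mathcal{A}$-vertex magic if it admits such a labeling, and group vertex magic if it is $\mathcal{A}$-vertex magic for every nontrivial abelian group $\mathcal{A}$. -}

module Defs where

open import Level using (Level; 0ℓ; _⊔_) renaming (suc to lsuc)
open import Algebra.Bundles using (AbelianGroup)
open import Data.Fin using (Fin; toℕ)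
open import Data.Fin.Properties using (_≟_; toℕ<n; toℕ-fromℕ<)
open import Data.List using (List; allFin; filter; foldr; map)
open import Data.Nat using (ℕ; suc; _+_; _≤_; _<_)
open import Data.Nat.DivMod using (_%_; _mod_; m<n⇒m%n≡m; n%n≡0; m%n<n)
open import Data.Nat.Properties using (m≤n⇒m<n∨m≡n; 1+n≢n; suc-injective)
open import Data.Product using (Σ-syntax; ∃-syntax; _×_)
open import Data.Sum using (_⊎_; inj₁; inj₂; swap; reduce)
open import Function.Bundles using (_↔_; _⇔_; Inverse)
open import Function.Definitions using (Injective)
open import Relation.Binary.Core using (Rel)
open import Relation.Binary.Definitions using (Decidable; Symmetric; Irreflexive)
open import Relation.Binary.PropositionalEquality using (_≡_; _≢_; refl; sym; trans; cong)
open import Relation.Nullary using (¬_)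
open import Relation.Nullary.Decidable using (_⊎-dec_)

record Graph (n : ℕ) : Set₁ where
  field
    Adj        : Rel (Fin n) 0ℓ
    adj?       : Decidable Adj
    adj-sym    : Symmetric Adj
    adj-irrefl : Irreflexive _≡_ Adj

  neighbours : Fin n → List (Fin n)
  neighbours v = filter (adj? v) (allFin n)

open Graph public

data Walk {n : ℕ} (G : Graph n) : Fin n → Fin n → ℕ → Set where
  nil  : ∀ {u} → Walk G u u 0
  cons : ∀ {u v w k} → Adj G u v → Walk G v w k → Walk G u w (suc k)

Connected : ∀ {n} → Graph n → Set
Connected G = ∀ u v → ∃[ k ] Walk G u v k

IsDistance : ∀ {n} → Graph n → Fin n → Fin n → ℕ → Set
IsDistance G u v d = Walk G u v d × (∀ k → Walk G u v k → d ≤ k)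

-- The diameter is the maximum of the pairwise distances (all of them finite).
HasDiameter : ∀ {n} → Graph n → ℕ → Set
HasDiameter G d =
  (∀ u v → ∃[ k ] (IsDistance G u v k × k ≤ d)) ×
  (∃[ u ] ∃[ v ] IsDistance G u v d)

-- i + 1 modulo 3 + m.
next : ∀ {m} → Fin (3 + m) → Fin (3 + m)
next {m} i = suc (toℕ i) mod (3 + m)

next-≢ : ∀ {m} (i : Fin (3 + m)) → i ≢ next i
next-≢ {m} i eq = case (m≤n⇒m<n∨m≡n (toℕ<n i))
  where
  N = 3 + m

  eqℕ : toℕ i ≡ suc (toℕ i) % N
  eqℕ = trans (cong toℕ eq) (toℕ-fromℕ< (m%n<n (suc (toℕ i)) N))

  case : ¬ (suc (toℕ i) < N ⊎ suc (toℕ i) ≡ N)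
  case (inj₁ lt) = 1+n≢n (sym (trans eqℕ (m<n⇒m%n≡m lt)))
  case (inj₂ e) with trans (sym (suc-injective e)) (trans eqℕ (trans (cong (_% N) e) (n%n≡0 N)))
  ... | ()

-- The cycle on 3 + m vertices.
cycleGraph : (m : ℕ) → Graph (3 + m)
cycleGraph m = record
  { Adj        = λ i j → j ≡ next i ⊎ i ≡ next j
  ; adj?       = λ i j → (j ≟ next i) ⊎-dec (i ≟ next j)
  ; adj-sym    = swap
  ; adj-irrefl = λ { {i} refl p → next-≢ i (reduce p) }
  }

C₄ : Graph 4
C₄ = cycleGraph 1

C₅ : Graph 5
C₅ = cycleGraph 2

-- A cycle of length 3 + m in G, presented by a cyclic enumeration of its
-- (distinct) vertices.
record CycleIn {n : ℕ} (G : Graph n) : Set where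
  field
    m         : ℕ
    vertex    : Fin (3 + m) → Fin n
    injective : Injective _≡_ _≡_ vertex
    adjacent  : ∀ i → Adj G (vertex i) (vertex (next i))

  Edge : Rel (Fin n) 0ℓ
  Edge u v = ∃[ i ] ((u ≡ vertex i × v ≡ vertex (next i)) ⊎
                     (v ≡ vertex i × u ≡ vertex (next i)))

-- Cycles are counted as subgraphs: enumerations that differ by a rotation or
-- a reflection have the same edges and present the same cycle.
SameCycle : ∀ {n} {G : Graph n} → CycleIn G → CycleIn G → Set
SameCycle c d = ∀ u v → CycleIn.Edge c u v ⇔ CycleIn.Edge d u v

Unicyclic : ∀ {n} → Graph n → Set
Unicyclic G = Connected G × Σ[ c ∈ CycleIn G ] (∀ d → SameCycle c d)

_≅_ : ∀ {m n} → Graph m → Graph n → Set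
_≅_ {m} {n} G H =
  Σ[ f ∈ (Fin m ↔ Fin n) ]
    (∀ u v → Adj G u v ⇔ Adj H (Inverse.to f u) (Inverse.to f v))

module _ {c ℓ : Level} (A : AbelianGroup c ℓ) where
  open AbelianGroup A

  Nontrivial : Set (c ⊔ ℓ)
  Nontrivial = ∃[ x ] ¬ (x ≈ ε)

  sum : List Carrier → Carrier
  sum = foldr _∙_ ε

  IsMagicLabeling : ∀ {n} → Graph n → (Fin n → Carrier) → Set (c ⊔ ℓ)
  IsMagicLabeling G l =
    (∀ v → ¬ (l v ≈ ε)) ×
    ∃[ μ ] (∀ v → sum (map l (neighbours G v)) ≈ μ)

  VertexMagic : ∀ {n} → Graph n → Set (c ⊔ ℓ)
  VertexMagic G = ∃[ l ] IsMagicLabeling G l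

-- c and ℓ are the universe levels of the carrier and equality of the groups.
GroupVertexMagic : (c ℓ : Level) → ∀ {n} → Graph n → Set (lsuc (c ⊔ ℓ))
GroupVertexMagic c ℓ G = (A : AbelianGroup c ℓ) → Nontrivial A → VertexMagic A G

{-# OPTIONS --safe #-}

-- If every vertex lies on the cycle c, then c has no chord, since a chord would
-- close a second cycle; so G is a cycle, and diameter 2 leaves only C₄ and C₅.
-- These are 2-regular, so every constant nonzero labeling is magic.
--
-- Otherwise some vertex v is off c, and then no cycle passes through v.  As all
-- distances are at most 2, any structure at v other than a single edge to a
-- vertex s of a triangle s a b would close a cycle of length 3, 4 or 5 through v.
-- Now N(v) = {s} and N(a) = {s, b}, so a magic labeling has
-- l(s) = l(s) + l(b), hence l(b) = 0: no group at all admits one.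

module Submission where

open import Defs
open import Level using (Level)
open import Algebra.Bundles using (AbelianGroup; CommutativeRing)
import Algebra.Construct.DirectProduct as DirectProduct
import Algebra.Construct.Terminal as Terminal
import Algebra.Properties.Group as GroupProperties
open import Data.Bool using (true)
open import Data.Bool.Properties using (xor-∧-commutativeRing)
open import Data.Fin using (Fin; toℕ)
open import Data.Fin.Patterns using (0F; 1F; 2F; 3F; 4F; 5F)
open import Data.Fin.Properties using (_≟_; all?; any?; toℕ<n; toℕ-fromℕ<; ¬∀⟶∃¬)
open import Data.List using (List; []; _∷_; allFin; map)
open import Data.List.Membership.Propositional using (_∈_)
open import Data.List.Membership.Propositional.Properties using (∈-filter⁺; ∈-filter⁻; ∈-allFin)
open import Data.List.Relation.Unary.All using (_∷_; lookup)
open import Data.List.Relation.Unary.AllPairs using (_∷_)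
open import Data.List.Relation.Unary.Any using (here; there)
open import Data.List.Relation.Unary.Unique.Propositional using (Unique)
open import Data.List.Relation.Unary.Unique.Propositional.Properties using (allFin⁺; filter⁺)
open import Data.Nat using (ℕ; suc; _+_; s≤s)
open import Data.Nat.DivMod using (_%_; m<n⇒m%n≡m; n%n≡0; m%n<n)
open import Data.Nat.Properties using (m≤n⇒m<n∨m≡n; m≢1+n+m)
open import Data.Product using (Σ-syntax; ∃-syntax; _×_; _,_; proj₁; proj₂)
open import Data.Sum using (_⊎_; inj₁; inj₂; [_,_]′; swap)
open import Data.Unit.Polymorphic using (tt)
open import Data.Vec as Vec using (Vec; []; _∷_)
open import Data.Vec.Relation.Unary.All using ([]; _∷_)
open import Data.Vec.Relation.Unary.AllPairs using ([]; _∷_)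
import Data.Vec.Relation.Unary.Unique.Propositional as VecUnique
open import Data.Vec.Relation.Unary.Unique.Propositional.Properties using (lookup-injective)
open import Function using (_∘_)
open import Function.Bundles using (_⇔_; mk⇔; mk↔ₛ′; Equivalence; Inverse)
open import Relation.Binary.PropositionalEquality using (_≡_; _≢_; refl; sym; trans; cong; subst; subst₂; ≢-sym)
open import Relation.Nullary using (¬_; Dec; yes; no; contradiction)
open import Relation.Nullary.Decidable using (from-yes; ¬?; _×-dec_; _⊎-dec_; _→-dec_)

private
  variable
    c ℓ : Level
    m n : ℕ

-- Neighbourhoods and labelings

unique-singleton : ∀ {a} {A : Set a} {xs : List A} {p} → Unique xs → p ∈ xs →
                   (∀ {x} → x ∈ xs → x ≡ p) → xs ≡ p ∷ []
unique-singleton {xs = x ∷ []} _ _ only = cong (_∷ []) (only (here refl))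
unique-singleton {xs = x ∷ y ∷ _} ((x≢y ∷ _) ∷ _) _ only =
  contradiction (trans (only (here refl)) (sym (only (there (here refl))))) x≢y

-- Neighbour lists inherit the order of `allFin`; nothing is known about how `p` and `q` compare
-- there, so both orders must be allowed.
unique-pair : ∀ {a} {A : Set a} {xs : List A} {p q} → Unique xs → p ≢ q → p ∈ xs → q ∈ xs →
              (∀ {x} → x ∈ xs → x ≡ p ⊎ x ≡ q) → xs ≡ p ∷ q ∷ [] ⊎ xs ≡ q ∷ p ∷ []
unique-pair {xs = x ∷ xs} (x∉xs ∷ uniq) = go
  where
  headed : ∀ {p q} → x ≡ p → p ≢ q → q ∈ x ∷ xs →
           (∀ {y} → y ∈ x ∷ xs → y ≡ p ⊎ y ≡ q) → x ∷ xs ≡ p ∷ q ∷ []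
  headed refl p≢q (here q≡p) _ = contradiction (sym q≡p) p≢q
  headed refl p≢q (there q∈xs) only = cong (x ∷_) (unique-singleton uniq q∈xs rest)
    where
    rest : ∀ {y} → y ∈ xs → y ≡ _
    rest y∈xs with only (there y∈xs)
    ... | inj₁ y≡p = contradiction (sym y≡p) (lookup x∉xs y∈xs)
    ... | inj₂ y≡q = y≡q

  go : ∀ {p q} → p ≢ q → p ∈ x ∷ xs → q ∈ x ∷ xs →
       (∀ {y} → y ∈ x ∷ xs → y ≡ p ⊎ y ≡ q) → x ∷ xs ≡ p ∷ q ∷ [] ⊎ x ∷ xs ≡ q ∷ p ∷ []
  go p≢q p∈ q∈ only with only (here refl)
  ... | inj₁ x≡p = inj₁ (headed x≡p p≢q q∈ only)
  ... | inj₂ x≡q = inj₂ (headed x≡q (≢-sym p≢q) p∈ (swap ∘ only))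

OneNeighbour : Graph n → Fin n → Fin n → Set
OneNeighbour G v p = ∀ x → Adj G v x ⇔ x ≡ p

TwoNeighbours : Graph n → Fin n → Fin n → Fin n → Set
TwoNeighbours G v p q = p ≢ q × (∀ x → Adj G v x ⇔ (x ≡ p ⊎ x ≡ q))

module _ (G : Graph n) {v : Fin n} where

  neighbours-unique : Unique (neighbours G v)
  neighbours-unique = filter⁺ (adj? G v) (allFin⁺ n)

  adj⇒∈-neighbours : ∀ {x} → Adj G v x → x ∈ neighbours G v
  adj⇒∈-neighbours = ∈-filter⁺ (adj? G v) (∈-allFin _)

  ∈-neighbours⇒adj : ∀ {x} → x ∈ neighbours G v → Adj G v x
  ∈-neighbours⇒adj = proj₂ ∘ ∈-filter⁻ (adj? G v) {xs = allFin n}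

  neighbours-singleton : ∀ {p} → OneNeighbour G v p → neighbours G v ≡ p ∷ []
  neighbours-singleton nb = unique-singleton neighbours-unique
    (adj⇒∈-neighbours (Equivalence.from (nb _) refl))
    (Equivalence.to (nb _) ∘ ∈-neighbours⇒adj)

  neighbours-pair : ∀ {p q} → TwoNeighbours G v p q →
                    neighbours G v ≡ p ∷ q ∷ [] ⊎ neighbours G v ≡ q ∷ p ∷ []
  neighbours-pair (p≢q , nb) = unique-pair neighbours-unique p≢q
    (adj⇒∈-neighbours (Equivalence.from (nb _) (inj₁ refl)))
    (adj⇒∈-neighbours (Equivalence.from (nb _) (inj₂ refl)))
    (Equivalence.to (nb _) ∘ ∈-neighbours⇒adj)

two-regular⇒groupVertexMagic : (G : Graph n) → (∀ v → ∃[ p ] ∃[ q ] TwoNeighbours G v p q) →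
                               GroupVertexMagic c ℓ G
-- `g ∙ (g ∙ ε)` is what `sum` computes on any two-element list of `g`, so both orders close by
-- reflexivity.
two-regular⇒groupVertexMagic G regular A (g , g≉ε) = (λ _ → g) , (λ _ → g≉ε) , g ∙ (g ∙ ε) , sums
  where
  open AbelianGroup A renaming (refl to ≈-refl)

  sums : ∀ v → sum A (map (λ _ → g) (neighbours G v)) ≈ g ∙ (g ∙ ε)
  sums v with neighbours-pair G (proj₂ (proj₂ (regular v)))
  ... | inj₁ eq rewrite eq = ≈-refl
  ... | inj₂ eq rewrite eq = ≈-refl

leaf-on-triangle⇒¬vertexMagic : (A : AbelianGroup c ℓ) (G : Graph n) {v s a b : Fin n} →
  OneNeighbour G v s → TwoNeighbours G a s b → ¬ VertexMagic A G
leaf-on-triangle⇒¬vertexMagic A G {v} {s} {a} {b} nv na (l , l≉ε , μ , magic) =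
  l≉ε b (identityʳ-unique (l s) (l b) (AbelianGroup.trans A sum-a (AbelianGroup.sym A sum-v)))
  where
  open AbelianGroup A hiding (refl; sym; trans)
  open GroupProperties group using (identityʳ-unique)
  module ≈ = AbelianGroup A

  sum-v : l s ≈ μ
  sum-v with magic v
  ... | eq rewrite neighbours-singleton G nv = ≈.trans (≈.sym (identityʳ (l s))) eq

  sum-a : l s ∙ l b ≈ μ
  sum-a with magic a | neighbours-pair G na
  ... | eq | inj₁ e rewrite e = ≈.trans (∙-congˡ (≈.sym (identityʳ (l b)))) eq
  ... | eq | inj₂ e rewrite e = ≈.trans (comm _ _) (≈.trans (∙-congˡ (≈.sym (identityʳ (l s)))) eq)

-- Refuting `GroupVertexMagic c ℓ` needs a group at exactly these levels: the booleans under xor,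
-- lifted by a product with the trivial group.
nontrivialGroup : (c ℓ : Level) → Σ[ A ∈ AbelianGroup c ℓ ] Nontrivial A
nontrivialGroup c ℓ =
  DirectProduct.abelianGroup (CommutativeRing.+-abelianGroup xor-∧-commutativeRing) (Terminal.abelianGroup {c} {ℓ}) ,
  (true , tt) , λ { (() , _) }

-- The successor on a cycle

next-cases : (i : Fin (3 + m)) → toℕ (next i) ≡ suc (toℕ i) ⊎
             (suc (toℕ i) ≡ 3 + m × toℕ (next i) ≡ 0)
next-cases {m} i with m≤n⇒m<n∨m≡n (toℕ<n i)
... | inj₁ lt = inj₁ (trans (toℕ-fromℕ< (m%n<n (suc (toℕ i)) (3 + m))) (m<n⇒m%n≡m lt))
... | inj₂ eq = inj₂ (eq , trans (toℕ-fromℕ< (m%n<n (suc (toℕ i)) (3 + m)))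
                                 (trans (cong (_% (3 + m)) eq) (n%n≡0 (3 + m))))

-- Without wrap-around the two steps add 2 to the value; with wrap-around a return would force the
-- length `3 + m` to be 1 or 2.
next²-≢ : (i : Fin (3 + m)) → i ≢ next (next i)
next²-≢ i eq with cong toℕ eq | next-cases i | next-cases (next i)
... | e | inj₁ p | inj₁ q = m≢1+n+m (toℕ i) (trans e (trans q (cong suc p)))
... | e | inj₁ p | inj₂ (r , q) with trans (cong suc (sym (trans p (cong suc (trans e q))))) r
... | ()
next²-≢ i eq | e | inj₂ (r , p) | inj₁ q with trans (cong suc (sym (trans e (trans q (cong suc p))))) r
... | ()
next²-≢ i eq | e | inj₂ (r , p) | inj₂ (s , _) with trans (cong suc (sym p)) s
... | ()

-- Leaves as possible chords only those that skip one vertex. Decidable, so evaluation settles it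
-- for lengths 4 and 5.
WithinTwo : ℕ → Set
WithinTwo m = (i j : Fin (3 + m)) → i ≡ j ⊎ (j ≡ next i ⊎ i ≡ next j) ⊎ (j ≡ next (next i) ⊎ i ≡ next (next j))

withinTwo? : ∀ m → Dec (WithinTwo m)
withinTwo? m = all? λ i → all? λ j →
  i ≟ j ⊎-dec (j ≟ next i ⊎-dec i ≟ next j) ⊎-dec (j ≟ next (next i) ⊎-dec i ≟ next (next j))

-- Excludes length 3, so that three steps from `i` lead outside the triangle `i`, `next i`,
-- `next (next i)`.
NoThreeStepReturn : ℕ → Set
NoThreeStepReturn m = (i : Fin (3 + m)) → i ≢ next (next (next i))

noThreeStepReturn? : ∀ m → Dec (NoThreeStepReturn m)
noThreeStepReturn? m = all? λ i → ¬? (i ≟ next (next (next i)))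

triangle-complete : (i j : Fin 3) → i ≡ j ⊎ (j ≡ next i ⊎ i ≡ next j)
triangle-complete = from-yes triangle-complete?
  where
  triangle-complete? : Dec ((i j : Fin 3) → i ≡ j ⊎ (j ≡ next i ⊎ i ≡ next j))
  triangle-complete? = all? λ i → all? λ j → i ≟ j ⊎-dec (j ≟ next i ⊎-dec i ≟ next j)

-- Two-regularity of the cycle in a form that can be decided for a fixed length: besides `next i`,
-- the only other neighbour of `i` is its unique preimage under `next`.
HasPredecessors : ℕ → Set
HasPredecessors m = (i : Fin (3 + m)) →
  ∃[ p ] (next i ≢ p × i ≡ next p × (∀ j → i ≡ next j → j ≡ p))

hasPredecessors? : ∀ m → Dec (HasPredecessors m)
hasPredecessors? m = all? λ i → any? λ p →
  ¬? (next i ≟ p) ×-dec i ≟ next p ×-dec all? (λ j → i ≟ next j →-dec j ≟ p)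

cycleGraph-two-regular : HasPredecessors m → ∀ i → ∃[ p ] ∃[ q ] TwoNeighbours (cycleGraph m) i p q
cycleGraph-two-regular pred i with pred i
... | p , next≢p , i≡next-p , only =
  next i , p , next≢p ,
  λ x → mk⇔ [ inj₁ , inj₂ ∘ only x ]′ [ inj₁ , (λ { refl → inj₂ i≡next-p }) ]′

≅-two-regular : (G : Graph n) (H : Graph m) → G ≅ H →
                (∀ i → ∃[ p ] ∃[ q ] TwoNeighbours H i p q) →
                ∀ v → ∃[ p ] ∃[ q ] TwoNeighbours G v p q
≅-two-regular G H (f , adj⇔) regular v with regular (Inverse.to f v)
... | p , q , p≢q , nb = from p , from q , from-≢ , λ x → mk⇔ (there′ x) (back x)
  where
  open Inverse f using (to; from; strictlyInverseˡ; strictlyInverseʳ)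

  from-≢ : from p ≢ from q
  from-≢ eq = p≢q (trans (sym (strictlyInverseˡ p)) (trans (cong to eq) (strictlyInverseˡ q)))

  pull : ∀ {x y} → to x ≡ y → x ≡ from y
  pull eq = trans (sym (strictlyInverseʳ _)) (cong from eq)

  push : ∀ {x y} → x ≡ from y → to x ≡ y
  push eq = trans (cong to eq) (strictlyInverseˡ _)

  there′ : ∀ x → Adj G v x → x ≡ from p ⊎ x ≡ from q
  there′ x a = [ inj₁ ∘ pull , inj₂ ∘ pull ]′ (Equivalence.to (nb (to x)) (Equivalence.to (adj⇔ v x) a))

  back : ∀ x → x ≡ from p ⊎ x ≡ from q → Adj G v x
  back x e = Equivalence.from (adj⇔ v x) (Equivalence.from (nb (to x)) ([ inj₁ ∘ push , inj₂ ∘ push ]′ e))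

≅-cycleGraph⇒groupVertexMagic : (G : Graph n) → HasPredecessors m → G ≅ cycleGraph m →
                                GroupVertexMagic c ℓ G
≅-cycleGraph⇒groupVertexMagic G pred iso =
  two-regular⇒groupVertexMagic G (≅-two-regular G (cycleGraph _) iso (cycleGraph-two-regular pred))

-- Short cycles from their vertices

module _ (G : Graph n) where

  adj⇒≢ : ∀ {u v} → Adj G u v → u ≢ v
  adj⇒≢ a eq = adj-irrefl G eq a

  cycleFromVec : (xs : Vec (Fin n) (3 + m)) → VecUnique.Unique xs →
                 (∀ i → Adj G (Vec.lookup xs i) (Vec.lookup xs (next i))) → CycleIn G
  cycleFromVec xs uniq adj = record
    { vertex    = Vec.lookup xs
    ; injective = lookup-injective uniq _ _
    ; adjacent  = adj
    }

  -- Adjacent vertices are distinct by irreflexivity, so only non-consecutive pairs need an explicit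
  -- inequality: none here, two in `quadrilateral`, five in `pentagon`.
  triangle : ∀ {x y z} → Adj G x y → Adj G y z → Adj G z x → CycleIn G
  triangle {x} {y} {z} xy yz zx = cycleFromVec (x ∷ y ∷ z ∷ [])
    ((adj⇒≢ xy ∷ ≢-sym (adj⇒≢ zx) ∷ []) ∷ (adj⇒≢ yz ∷ []) ∷ [] ∷ [])
    λ { 0F → xy ; 1F → yz ; 2F → zx }

  quadrilateral : ∀ {x y z w} → Adj G x y → Adj G y z → Adj G z w → Adj G w x →
                  x ≢ z → y ≢ w → CycleIn G
  quadrilateral {x} {y} {z} {w} xy yz zw wx x≢z y≢w = cycleFromVec (x ∷ y ∷ z ∷ w ∷ [])
    ((adj⇒≢ xy ∷ x≢z ∷ ≢-sym (adj⇒≢ wx) ∷ []) ∷ (adj⇒≢ yz ∷ y≢w ∷ []) ∷ (adj⇒≢ zw ∷ []) ∷ [] ∷ [])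
    λ { 0F → xy ; 1F → yz ; 2F → zw ; 3F → wx }

  pentagon : ∀ {x y z w t} → Adj G x y → Adj G y z → Adj G z w → Adj G w t → Adj G t x →
             x ≢ z → x ≢ w → y ≢ w → y ≢ t → z ≢ t → CycleIn G
  pentagon {x} {y} {z} {w} {t} xy yz zw wt tx x≢z x≢w y≢w y≢t z≢t = cycleFromVec (x ∷ y ∷ z ∷ w ∷ t ∷ [])
    ((adj⇒≢ xy ∷ x≢z ∷ x≢w ∷ ≢-sym (adj⇒≢ tx) ∷ []) ∷
     (adj⇒≢ yz ∷ y≢w ∷ y≢t ∷ []) ∷ (adj⇒≢ zw ∷ z≢t ∷ []) ∷ (adj⇒≢ wt ∷ []) ∷ [] ∷ [])
    λ { 0F → xy ; 1F → yz ; 2F → zw ; 3F → wt ; 4F → tx }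

  Reachable₂ : Fin n → Fin n → Set
  Reachable₂ u v = u ≡ v ⊎ Adj G u v ⊎ ∃[ w ] (Adj G u w × Adj G w v)

  diameter-2⇒reachable₂ : HasDiameter G 2 → ∀ u v → Reachable₂ u v
  diameter-2⇒reachable₂ (dist , _) u v with dist u v
  ... | 0 , (nil , _) , _ = inj₁ refl
  ... | 1 , (cons a nil , _) , _ = inj₂ (inj₁ a)
  ... | 2 , (cons a (cons b nil) , _) , _ = inj₂ (inj₂ (_ , a , b))
  ... | suc (suc (suc _)) , _ , s≤s (s≤s ())

  distance-2-pair : HasDiameter G 2 → ∃[ u ] ∃[ v ] (u ≢ v × ¬ Adj G u v)
  distance-2-pair (_ , u , v , _ , least) =
    u , v , (λ { refl → contradiction (least 0 nil) λ () }) ,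
    λ a → contradiction (least 1 (cons a nil)) λ { (s≤s ()) }

-- The classification

module _ (G : Graph n) (uni : Unicyclic G) where

  -- The edge of `d` leaving position `i` is an edge of the unique cycle, hence of `e`, and its
  -- endpoints lie on `e`. Uniqueness is used below in this form: a cycle is refuted by a vertex
  -- that it misses.
  vertex-on-every-cycle : (d e : CycleIn G) (i : Fin (3 + CycleIn.m d)) →
                          ∃[ j ] CycleIn.vertex d i ≡ CycleIn.vertex e j
  vertex-on-every-cycle d e i
    with Equivalence.to (proj₂ (proj₂ uni) e _ _)
           (Equivalence.from (proj₂ (proj₂ uni) d _ _) (i , inj₁ (refl , refl)))
  ... | j , inj₁ (eq , _) = j , eq
  ... | j , inj₂ (_ , eq) = next j , eq

-- Vertices off the cycle

module _ (G : Graph n) (uni : Unicyclic G) (diam : HasDiameter G 2) where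

  private
    C : CycleIn G
    C = proj₁ (proj₂ uni)

    reach : ∀ u v → Reachable₂ G u v
    reach = diameter-2⇒reachable₂ G diam

    ~sym : ∀ {u v} → Adj G u v → Adj G v u
    ~sym = adj-sym G

  open CycleIn C using (vertex; injective; adjacent)

  module OffCycle (v : Fin n) (off : ∀ i → v ≢ vertex i) where

    no-cycle-through : (d : CycleIn G) (i : Fin (3 + CycleIn.m d)) → v ≢ CycleIn.vertex d i
    no-cycle-through d i eq with vertex-on-every-cycle G uni d C i
    ... | j , eq′ = off j (trans eq eq′)

    no-triangle : ∀ {x y} → Adj G v x → Adj G x y → ¬ Adj G y v
    no-triangle vx xy yv = no-cycle-through (triangle G vx xy yv) 0F refl

    no-quadrilateral : ∀ {x y z} → Adj G v x → Adj G x y → Adj G y z → Adj G z v →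
                       v ≢ y → ¬ (x ≢ z)
    no-quadrilateral vx xy yz zv v≢y x≢z =
      no-cycle-through (quadrilateral G vx xy yz zv v≢y x≢z) 0F refl

    no-pentagon : ∀ {x y z w} → Adj G v x → Adj G x y → Adj G y z → Adj G z w → Adj G w v →
                  v ≢ y → v ≢ z → x ≢ z → x ≢ w → ¬ (y ≢ w)
    no-pentagon vx xy yz zw wv v≢y v≢z x≢z x≢w y≢w =
      no-cycle-through (pentagon G vx xy yz zw wv v≢y v≢z x≢z x≢w y≢w) 0F refl

    -- Join `v` to two consecutive cycle vertices by paths of length at most 2. If both have length
    -- 2 and their midpoints `w`, `x` are distinct and not among these two vertices, a pentagon
    -- passes through `v`.
    attached : ∃[ i ] Adj G v (vertex i)
    attached with reach v (vertex 0F) | reach v (vertex 1F)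
    ... | inj₁ eq | _ = contradiction eq (off 0F)
    ... | inj₂ (inj₁ a) | _ = 0F , a
    ... | inj₂ (inj₂ _) | inj₁ eq = contradiction eq (off 1F)
    ... | inj₂ (inj₂ _) | inj₂ (inj₁ a) = 1F , a
    ... | inj₂ (inj₂ (w , vw , wc₀)) | inj₂ (inj₂ (x , vx , xc₁)) with w ≟ x | w ≟ vertex 1F | x ≟ vertex 0F
    ...   | _ | yes refl | _ = 1F , vw
    ...   | _ | _ | yes refl = 0F , vx
    ...   | no w≢x | no w≢c₁ | no x≢c₀ = contradiction (≢-sym x≢c₀)
              (no-pentagon vw wc₀ (adjacent 0F) (~sym xc₁) (~sym vx) (off 0F) (off 1F) w≢c₁ w≢x)
    -- A common midpoint forms a triangle with the two cycle vertices; by uniqueness this triangle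
    -- is `C`, so `w` lies on `C`.
    ...   | yes refl | _ | _ with vertex-on-every-cycle G uni (triangle G wc₀ (adjacent 0F) (~sym xc₁)) C 0F
    ...     | i , eq = i , subst (Adj G v) eq vw

    -- Let `a`, `b` follow the attachment vertex `s` on `C`. Among the short paths from `v` to `b`,
    -- only the one through `s` avoids closing a cycle through `v`, and it supplies the edge between
    -- `s` and `b`.
    triangle-at-attachment : ∃[ s ] ∃[ a ] ∃[ b ]
      (Adj G v s × Adj G s a × Adj G a b × Adj G b s × v ≢ a × v ≢ b)
    triangle-at-attachment with attached
    ... | i , vs = vertex i , vertex (next i) , vertex (next (next i)) ,
                   vs , adjacent i , adjacent (next i) , closing ,
                   off _ , off _
      where
      s≢b : vertex i ≢ vertex (next (next i))
      s≢b eq = next²-≢ i (injective eq)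

      closing : Adj G (vertex (next (next i))) (vertex i)
      closing with reach v (vertex (next (next i)))
      ... | inj₁ eq = contradiction eq (off _)
      ... | inj₂ (inj₁ vb) = contradiction s≢b
              (no-quadrilateral vs (adjacent i) (adjacent (next i)) (~sym vb) (off _))
      ... | inj₂ (inj₂ (w , vw , wb)) with w ≟ vertex i | w ≟ vertex (next i)
      ...   | yes refl | _ = ~sym wb
      ...   | no _ | yes refl = contradiction (~sym vw) (no-triangle vs (adjacent i))
      ...   | no w≢s | no w≢a = contradiction (≢-sym w≢a)
                (no-pentagon vs (adjacent i) (adjacent (next i)) (~sym wb) (~sym vw)
                  (off _) (off _) s≢b (≢-sym w≢s))

    -- A second neighbour of `v` would be within distance 2 of `a`, which closes a cycle of length
    -- 3, 4 or 5 through `v`. Hence a path of length 2 from `v` to a neighbour of `a` runs through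
    -- `s`.
    leaf-on-triangle : ∃[ s ] ∃[ a ] ∃[ b ] (OneNeighbour G v s × TwoNeighbours G a s b)
    leaf-on-triangle with triangle-at-attachment
    ... | s , a , b , vs , sa , ab , bs , v≢a , v≢b =
      s , a , b , (λ x → mk⇔ (only-s x) λ { refl → vs }) ,
      ≢-sym (adj⇒≢ G bs) , λ x → mk⇔ (only-s-b x) [ (λ { refl → ~sym sa }) , (λ { refl → ab }) ]′
      where
      only-s : ∀ x → Adj G v x → x ≡ s
      only-s x vx with x ≟ s
      ... | yes eq = eq
      ... | no x≢s with reach x a
      ...   | inj₁ refl = contradiction (~sym vx) (no-triangle vs sa)
      ...   | inj₂ (inj₁ xa) = contradiction x≢s (no-quadrilateral vx xa (~sym sa) (~sym vs) v≢a)
      ...   | inj₂ (inj₂ (y , xy , ya)) with v ≟ y | y ≟ s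
      ...     | yes refl | _ = contradiction (~sym ya) (no-triangle vs sa)
      ...     | no _ | yes refl = contradiction (~sym vs) (no-triangle vx xy)
      ...     | no v≢y | no y≢s with x ≟ a
      ...       | yes refl = contradiction (~sym vx) (no-triangle vs sa)
      ...       | no x≢a = contradiction y≢s
                    (no-pentagon vx xy ya (~sym sa) (~sym vs) v≢y v≢a x≢a x≢s)

      only-s-b : ∀ x → Adj G a x → x ≡ s ⊎ x ≡ b
      only-s-b x ax with reach v x
      ... | inj₁ refl = contradiction ax (no-triangle vs sa)
      ... | inj₂ (inj₁ vx) = inj₁ (only-s x vx)
      ... | inj₂ (inj₂ (y , vy , yx)) with only-s y vy
      -- Now `s`, `a`, `x` form a triangle, which must be the triangle `s`, `a`, `b`.
      ...   | refl with vertex-on-every-cycle G uni (triangle G sa ax (~sym yx)) (triangle G sa ab bs) 2F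
      ...     | 0F , eq = inj₁ eq
      ...     | 1F , eq = contradiction (sym eq) (adj⇒≢ G ax)
      ...     | 2F , eq = inj₂ eq

  off-cycle⇒¬vertexMagic : (A : AbelianGroup c ℓ) (v : Fin n) → (∀ i → v ≢ vertex i) → ¬ VertexMagic A G
  off-cycle⇒¬vertexMagic A v off with OffCycle.leaf-on-triangle v off
  ... | _ , _ , _ , nv , na = leaf-on-triangle⇒¬vertexMagic A G nv na

-- Spanning cycles

module _ (G : Graph n) (uni : Unicyclic G) where

  private
    module U = CycleIn (proj₁ (proj₂ uni))

  -- As the cycle is spanning, `vertex` is a bijection with inverse `index`. Cycle edges map to
  -- edges by `adjacent`; conversely `within` leaves only chords skipping one vertex to exclude.
  spanning-cycle⇒≅ : NoThreeStepReturn U.m → WithinTwo U.m → (∀ v → ∃[ i ] v ≡ U.vertex i) →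
                     G ≅ cycleGraph U.m
  spanning-cycle⇒≅ noReturn within on = iso , λ u v → mk⇔ (to-cycle u v) (from-cycle u v)
    where
    open U using (vertex; injective; adjacent)

    index : Fin n → Fin (3 + U.m)
    index = proj₁ ∘ on

    vertex-index : ∀ v → vertex (index v) ≡ v
    vertex-index = sym ∘ proj₂ ∘ on

    iso = mk↔ₛ′ index vertex (λ i → injective (vertex-index (vertex i))) vertex-index

    -- A chord skipping one vertex closes a triangle that misses the next vertex.
    no-chord : ∀ i → ¬ Adj G (vertex i) (vertex (next (next i)))
    no-chord i chord
      with vertex-on-every-cycle G uni (proj₁ (proj₂ uni))
             (triangle G (adjacent i) (adjacent (next i)) (adj-sym G chord)) (next (next (next i)))
    ... | 0F , eq = noReturn i (sym (injective eq))
    ... | 1F , eq = next²-≢ (next i) (sym (injective eq))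
    ... | 2F , eq = next-≢ (next (next i)) (sym (injective eq))

    induced : ∀ i j → Adj G (vertex i) (vertex j) → Adj (cycleGraph U.m) i j
    induced i j a with within i j
    ... | inj₁ refl = contradiction refl (adj⇒≢ G a)
    ... | inj₂ (inj₁ adj) = adj
    ... | inj₂ (inj₂ (inj₁ refl)) = contradiction a (no-chord i)
    ... | inj₂ (inj₂ (inj₂ refl)) = contradiction (adj-sym G a) (no-chord j)

    to-cycle : ∀ u v → Adj G u v → Adj (cycleGraph U.m) (index u) (index v)
    to-cycle u v a = induced _ _ (subst₂ (Adj G) (sym (vertex-index u)) (sym (vertex-index v)) a)

    from-cycle : ∀ u v → Adj (cycleGraph U.m) (index u) (index v) → Adj G u v
    from-cycle u v a = subst₂ (Adj G) (vertex-index u) (vertex-index v) (edge a)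
      where
      edge : ∀ {i j} → Adj (cycleGraph U.m) i j → Adj G (vertex i) (vertex j)
      edge (inj₁ refl) = adjacent _
      edge (inj₂ refl) = adj-sym G (adjacent _)

spanning-cycle⇒C₄⊎C₅ : (G : Graph n) (uni : Unicyclic G) → HasDiameter G 2 →
  (∀ v → ∃[ i ] v ≡ CycleIn.vertex (proj₁ (proj₂ uni)) i) → G ≅ C₄ ⊎ G ≅ C₅
-- A spanning triangle makes `G` complete, but diameter 2 supplies two distinct non-adjacent
-- vertices.
spanning-cycle⇒C₄⊎C₅ G uni@(_ , record { m = 0 ; vertex = vertex ; adjacent = adjacent } , _) diam on
  with distance-2-pair G diam
... | u , v , u≢v , ¬uv with on u | on v
... | i , refl | j , refl with triangle-complete i j
... | inj₁ refl = contradiction refl u≢v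
... | inj₂ (inj₁ refl) = contradiction (adjacent i) ¬uv
... | inj₂ (inj₂ refl) = contradiction (adj-sym G (adjacent j)) ¬uv
spanning-cycle⇒C₄⊎C₅ G uni@(_ , record { m = 1 } , _) diam on =
  inj₁ (spanning-cycle⇒≅ G uni (from-yes (noThreeStepReturn? 1)) (from-yes (withinTwo? 1)) on)
spanning-cycle⇒C₄⊎C₅ G uni@(_ , record { m = 2 } , _) diam on =
  inj₂ (spanning-cycle⇒≅ G uni (from-yes (noThreeStepReturn? 2)) (from-yes (withinTwo? 2)) on)
-- With at least six vertices, joining vertices 0 and 3 by a path of length at most 2
-- closes a cycle of length at most 5, which misses some vertex.
spanning-cycle⇒C₄⊎C₅ G uni@(_ , C@record { m = suc (suc (suc m)) ; vertex = vertex ; injective = injective ; adjacent = adjacent } , _) diam on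
  with diameter-2⇒reachable₂ G diam (vertex 0F) (vertex 3F)
... | inj₁ eq = contradiction (injective eq) λ ()
... | inj₂ (inj₁ chord) = contradiction
        (vertex-on-every-cycle G uni C
          (quadrilateral G (adjacent 0F) (adjacent 1F) (adjacent 2F) (adj-sym G chord)
            ((λ ()) ∘ injective) ((λ ()) ∘ injective)) 4F)
        λ { (0F , eq) → contradiction (injective eq) λ ()
          ; (1F , eq) → contradiction (injective eq) λ ()
          ; (2F , eq) → contradiction (injective eq) λ ()
          ; (3F , eq) → contradiction (injective eq) λ () }
... | inj₂ (inj₂ (w , 0w , w3)) with w ≟ vertex 1F | w ≟ vertex 2F
...   | yes refl | _ = contradiction
        (vertex-on-every-cycle G uni C (triangle G (adjacent 1F) (adjacent 2F) (adj-sym G w3)) 0F)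
        λ { (0F , eq) → contradiction (injective eq) λ ()
          ; (1F , eq) → contradiction (injective eq) λ ()
          ; (2F , eq) → contradiction (injective eq) λ () }
...   | no _ | yes refl = contradiction
        (vertex-on-every-cycle G uni C (triangle G (adjacent 0F) (adjacent 1F) (adj-sym G 0w)) 3F)
        λ { (0F , eq) → contradiction (injective eq) λ ()
          ; (1F , eq) → contradiction (injective eq) λ ()
          ; (2F , eq) → contradiction (injective eq) λ () }
-- The pentagon on vertices 0 to 3 and `w` must contain all of `C`; vertices 4 and 5 would both have
-- to be `w`.
...   | no w≢1 | no w≢2 = contradiction (injective (trans is-w₄ (sym is-w₅))) λ ()
  where
  P : CycleIn G
  P = pentagon G (adjacent 0F) (adjacent 1F) (adjacent 2F) (adj-sym G w3) (adj-sym G 0w)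
        ((λ ()) ∘ injective) ((λ ()) ∘ injective) ((λ ()) ∘ injective) (≢-sym w≢1) (≢-sym w≢2)

  is-w₄ : vertex 4F ≡ w
  is-w₄ with vertex-on-every-cycle G uni C P 4F
  ... | 0F , eq = contradiction (injective eq) λ ()
  ... | 1F , eq = contradiction (injective eq) λ ()
  ... | 2F , eq = contradiction (injective eq) λ ()
  ... | 3F , eq = contradiction (injective eq) λ ()
  ... | 4F , eq = eq

  is-w₅ : vertex 5F ≡ w
  is-w₅ with vertex-on-every-cycle G uni C P 5F
  ... | 0F , eq = contradiction (injective eq) λ ()
  ... | 1F , eq = contradiction (injective eq) λ ()
  ... | 2F , eq = contradiction (injective eq) λ ()
  ... | 3F , eq = contradiction (injective eq) λ ()
  ... | 4F , eq = eq

-- The equivalence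

groupVertexMagic⇒C₄⊎C₅ : (G : Graph n) → Unicyclic G → HasDiameter G 2 →
                         GroupVertexMagic c ℓ G → G ≅ C₄ ⊎ G ≅ C₅
groupVertexMagic⇒C₄⊎C₅ {n} {c} {ℓ} G uni diam magic
  -- Lying on the cycle is decidable by finite search, so if the cycle is not spanning, an actual
  -- vertex off it can be extracted.
  with all? (λ v → any? (λ i → v ≟ CycleIn.vertex (proj₁ (proj₂ uni)) i))
... | yes on = spanning-cycle⇒C₄⊎C₅ G uni diam on
... | no ¬on with ¬∀⟶∃¬ n _ (λ v → any? (λ i → v ≟ CycleIn.vertex (proj₁ (proj₂ uni)) i)) ¬on
...   | v , off = contradiction (magic A nontrivial)
                    (off-cycle⇒¬vertexMagic G uni diam A v (λ i eq → off (i , eq)))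
  where
  A = proj₁ (nontrivialGroup c ℓ)
  nontrivial = proj₂ (nontrivialGroup c ℓ)

theorem3p1 : (c ℓ : Level) (n : ℕ) (G : Graph n) → Unicyclic G → HasDiameter G 2 →
    GroupVertexMagic c ℓ G ⇔ (G ≅ C₄ ⊎ G ≅ C₅)
theorem3p1 c ℓ n G uni diam = mk⇔ (groupVertexMagic⇒C₄⊎C₅ G uni diam)
  [ ≅-cycleGraph⇒groupVertexMagic G (from-yes (hasPredecessors? 1))
  , ≅-cycleGraph⇒groupVertexMagic G (from-yes (hasPredecessors? 2)) ]′
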